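{- There exists an infinite strictly increasing sequence of square-primes $A_1<A_2<A_3<\cdots$ such that the P-G triangle generated by $\mathfrak u=(A_1,A_2,A_3,\dots)$ has left edge $(b_0,b_1,b_2,\dots)$ satisfying $b_j=1$ for every odd index $j\ge 1$ (that is, every other element of the left edge, starting with the second one, equals $1$).
   Context: A square-prime (SP-number) is a positive integer of the form $k^2p$ with $k\ge 2$ an integer and $p$ a prime. For a finite or infinite sequence $\mathfrak u=(a_0,a_1,\dots)$ of non-negative integers, the P-G triangle generated by $\mathfrak u$ consists of the numbers $d_k^{(j)}$ defined by $d_k^{(0)}=a_k$ and $d_k^{(j+1)}=|d_{k+1}^{(j)}-d_k^{(j)}|$ for $j,k\ge 0$ (for a finite sequence $(a_0,\dots,a_{N-1})$ these are defined for $0\le k\le N-1-j$). Its left (western) edge is the sequence $b_j=d_0^{(j)}$, $j\ge 0$ (so $b_0=a_0$). -}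

module Defs where

open import Data.Nat using (ℕ; zero; suc; _*_; _^_; _≤_; ∣_-_∣)
open import Data.Nat.Primality using (Prime)
open import Data.Product using (_×_; ∃₂)
open import Relation.Binary.PropositionalEquality using (_≡_)

SquarePrime : ℕ → Set
SquarePrime n = ∃₂ λ k p → 2 ≤ k × Prime p × n ≡ k ^ 2 * p

-- The P-G triangle generated by the infinite sequence u:
-- triangle u j k is d_k^(j), the k-th entry of row j.
triangle : (ℕ → ℕ) → ℕ → ℕ → ℕ
triangle u zero    k = u k
triangle u (suc j) k = ∣ triangle u j (suc k) - triangle u j k ∣

leftEdge : (ℕ → ℕ) → ℕ → ℕ
leftEdge u j = triangle u j 0

{-# OPTIONS --safe #-}
module Submission where

open import Defs
open import Data.Nat using
  ( ℕ; zero; suc; _+_; _*_; _^_; _∸_; _/_; _%_; ∣_-_∣; _≤_; _<_; z≤n; s≤s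
  ; _≤′_; ≤′-refl; ≤′-step; NonZero; >-nonZero )
open import Data.Nat.DivMod using (m≡m%n+[m/n]*n)
open import Data.Nat.Primality using (Prime; prime?; prime⇒nonZero)
open import Data.Nat.Properties
open import Data.Nat.Solver using (module +-*-Solver)
open import Data.Nat.Tactic.RingSolver using (solve-∀)
open import Data.Product using (_×_; ∃; ∃₂; _,_; proj₁; proj₂)
open import Function using (_∘_)
open import Relation.Binary.Core using (Rel; _Preserves_⟶_)
open import Relation.Binary.PropositionalEquality
open import Relation.Nullary.Decidable using (from-yes)

-- The sequence is built so that A (2m+1) = A (2m) + 2^m, with A (2m) enormous
-- compared to everything before it.  Such pairs of square-primes are multiples
-- by a power of 4 of solutions of the Pell-type equations 3x² = 2y² + 1 and
-- 5x² = 3y² + 2.  Entries on the antidiagonal through A (2m) are then huge, so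
-- the absolute values involving them resolve with a known sign and cancel:
-- the entry in row 2i+1 and position 2l is 2^(l+1) − 2^l = 2^l for every i.
-- The case l = 0 is the claim.

-- Pairs of square-primes at distance a power of two.

CofinalPairs : ℕ → Set
CofinalPairs e = ∀ N → ∃ λ n → N ≤ n × SquarePrime n × SquarePrime (n + e)

square-prime-*4 : ∀ {n} → SquarePrime n → SquarePrime (4 * n)
square-prime-*4 (k , p , 2≤k , p-prime , refl) =
  2 * k , p , ≤-trans 2≤k (m≤n*m k 2) , p-prime , identity k p
  where
  open +-*-Solver
  identity : ∀ k p → 4 * (k ^ 2 * p) ≡ (2 * k) ^ 2 * p
  identity = solve 2 (λ k p →
    con 4 :* (k :^ 2 :* p) := (con 2 :* k) :^ 2 :* p) refl

cofinal-pairs-*4 : ∀ {e} → CofinalPairs e → CofinalPairs (4 * e)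
cofinal-pairs-*4 {e} pairs N with pairs N
... | n , N≤n , sp , sp′ =
  4 * n , ≤-trans N≤n (m≤n*m n 4) , square-prime-*4 sp ,
  subst SquarePrime (*-distribˡ-+ 4 n e) (square-prime-*4 sp′)

-- Multiplying `x√p + y√q` by the unit `a + b√(pq)` gives `(ax + bqy)√p + (ay + bpx)√q`, and the
-- unit has norm 1, so `px² − qy²` is preserved.
pell-step : ∀ p q e a b x y → a ^ 2 ≡ b ^ 2 * (p * q) + 1 → x ^ 2 * p ≡ y ^ 2 * q + e →
            (a * x + b * q * y) ^ 2 * p ≡ (a * y + b * p * x) ^ 2 * q + e
pell-step p q e a b x y unit solution = begin
  (a * x + b * q * y) ^ 2 * p
    ≡⟨ expandˡ p q a b x y ⟩
  a ^ 2 * (x ^ 2 * p) + cross + b ^ 2 * (p * q) * (y ^ 2 * q)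
    ≡⟨ cong₂ (λ s t → s * t + cross + b ^ 2 * (p * q) * (y ^ 2 * q)) unit solution ⟩
  (b ^ 2 * (p * q) + 1) * (y ^ 2 * q + e) + cross + b ^ 2 * (p * q) * (y ^ 2 * q)
    -- The hypotheses are applied forwards above and backwards below; in between, `(d + 1) * e` is
    -- split as `d * e + e`, so no subtraction occurs.
    ≡⟨ regroup (b ^ 2 * (p * q)) (y ^ 2 * q) e cross ⟩
  (b ^ 2 * (p * q) + 1) * (y ^ 2 * q) + cross + b ^ 2 * (p * q) * (y ^ 2 * q + e) + e
    ≡⟨ cong₂ (λ s t → s * (y ^ 2 * q) + cross + b ^ 2 * (p * q) * t + e) unit solution ⟨
  a ^ 2 * (y ^ 2 * q) + cross + b ^ 2 * (p * q) * (x ^ 2 * p) + e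
    ≡⟨ cong (_+ e) (expandʳ p q a b x y) ⟨
  (a * y + b * p * x) ^ 2 * q + e
    ∎
  where
  open ≡-Reasoning
  open +-*-Solver
  cross : ℕ
  cross = 2 * (a * b * p * q * x * y)
  expandˡ : ∀ p q a b x y → (a * x + b * q * y) ^ 2 * p ≡
            a ^ 2 * (x ^ 2 * p) + 2 * (a * b * p * q * x * y) + b ^ 2 * (p * q) * (y ^ 2 * q)
  expandˡ = solve 6 (λ p q a b x y →
    (a :* x :+ b :* q :* y) :^ 2 :* p :=
    a :^ 2 :* (x :^ 2 :* p) :+ con 2 :* (a :* b :* p :* q :* x :* y)
      :+ b :^ 2 :* (p :* q) :* (y :^ 2 :* q)) refl
  expandʳ : ∀ p q a b x y → (a * y + b * p * x) ^ 2 * q ≡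
            a ^ 2 * (y ^ 2 * q) + 2 * (a * b * p * q * x * y) + b ^ 2 * (p * q) * (x ^ 2 * p)
  expandʳ = solve 6 (λ p q a b x y →
    (a :* y :+ b :* p :* x) :^ 2 :* q :=
    a :^ 2 :* (y :^ 2 :* q) :+ con 2 :* (a :* b :* p :* q :* x :* y)
      :+ b :^ 2 :* (p :* q) :* (x :^ 2 :* p)) refl
  regroup : ∀ d r e c → (d + 1) * (r + e) + c + d * r ≡ (d + 1) * r + c + d * (r + e) + e
  regroup = solve-∀

pell-cofinal-pairs :
  ∀ p q e a b x y .{{_ : NonZero a}} .{{_ : NonZero b}} → Prime p → Prime q →
  a ^ 2 ≡ b ^ 2 * (p * q) + 1 → 2 ≤ x → 2 ≤ y → x ^ 2 * p ≡ y ^ 2 * q + e → CofinalPairs e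
pell-cofinal-pairs p q e a b x₀ y₀ p-prime q-prime unit 2≤x₀ 2≤y₀ solution₀ N
  with solutions N
  where
  instance
    p≢0 : NonZero p
    p≢0 = prime⇒nonZero p-prime
    bp≢0 : NonZero (b * p)
    bp≢0 = m*n≢0 b p

  solutions : ∀ N → ∃₂ λ x y → 2 ≤ x × 2 ≤ y × N ≤ y × x ^ 2 * p ≡ y ^ 2 * q + e
  solutions zero = x₀ , y₀ , 2≤x₀ , 2≤y₀ , z≤n , solution₀
  solutions (suc N) with solutions N
  ... | x , y , 2≤x , 2≤y , N≤y , solution =
    a * x + b * q * y , a * y + b * p * x ,
    ≤-trans 2≤x (≤-trans (m≤n*m x a) (m≤m+n (a * x) _)) ,
    ≤-trans 2≤y (≤-trans (m≤n*m y a) (m≤m+n (a * y) _)) ,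
    -- `a * y` is at least `N`, and `b * p * x ≥ x ≥ 2` supplies the extra 1.
    subst (_≤ a * y + b * p * x) (+-comm N 1)
      (+-mono-≤ (≤-trans N≤y (m≤n*m y a)) (≤-trans (n≤1+n 1) (≤-trans 2≤x (m≤n*m x (b * p))))) ,
    pell-step p q e a b x y unit solution
... | x , y , 2≤x , 2≤y , N≤y , solution =
  y ^ 2 * q , N≤y²q , (y , q , 2≤y , q-prime , refl) , (x , p , 2≤x , p-prime , sym solution)
  where
  N≤y²q : N ≤ y ^ 2 * q
  N≤y²q = begin
    N          ≤⟨ N≤y ⟩
    y          ≤⟨ m≤m*n y (y ^ 1) {{m^n≢0 y 1 {{>-nonZero (≤-trans (s≤s z≤n) 2≤y)}}}} ⟩
    y ^ 2      ≤⟨ m≤m*n (y ^ 2) q {{prime⇒nonZero q-prime}} ⟩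
    y ^ 2 * q  ∎
    where open ≤-Reasoning

-- Scaling by 4 reduces everything to gaps 1 and 2. The trivial solution `x = y = 1` of each
-- equation violates `2 ≤ x`, so each seed, (9, 11) or (7, 9), is its image under one Pell step.
cofinal-pairs-2^ : ∀ m → CofinalPairs (2 ^ m)
cofinal-pairs-2^ 0 =
  pell-cofinal-pairs 3 2 1 5 2 9 11 (from-yes (prime? 3)) (from-yes (prime? 2))
    refl (s≤s (s≤s z≤n)) (s≤s (s≤s z≤n)) refl
cofinal-pairs-2^ 1 =
  pell-cofinal-pairs 5 3 2 4 1 7 9 (from-yes (prime? 5)) (from-yes (prime? 3))
    refl (s≤s (s≤s z≤n)) (s≤s (s≤s z≤n)) refl
cofinal-pairs-2^ (suc (suc m)) =
  subst CofinalPairs (*-assoc 2 2 (2 ^ m)) (cofinal-pairs-*4 (cofinal-pairs-2^ m))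

-- Bounds on entries for a monotone sequence.

module _ {u : ℕ → ℕ} (u-mono : ∀ n → u n ≤ u (suc n)) where

  triangle-upper : ∀ j k → triangle u j k ≤ u (j + k)
  triangle-upper zero    k = ≤-refl
  triangle-upper (suc j) k = ≤-trans (∣m-n∣≤m⊔n (triangle u j (suc k)) (triangle u j k)) (⊔-lub
    (subst (λ i → triangle u j (suc k) ≤ u i) (+-suc j k) (triangle-upper j (suc k)))
    (≤-trans (triangle-upper j k) (u-mono (j + k))))

  -- Down the antidiagonal from `u (j + suc k)`, each of the `j` steps takes the difference with an
  -- entry built from earlier terms only, hence at most `u (j + k)`.
  triangle-lower : ∀ j k → u (j + suc k) ≤ j * u (j + k) + triangle u j (suc k)
  triangle-lower zero    k = ≤-refl
  triangle-lower (suc j) k = begin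
    u (suc j + suc k)
      ≡⟨ cong u (+-suc j (suc k)) ⟨
    u (j + suc (suc k))
      ≤⟨ triangle-lower j (suc k) ⟩
    j * M + triangle u j (suc (suc k))
      ≤⟨ +-monoʳ-≤ (j * M) (m≤n+∣m-n∣ (triangle u j (suc (suc k))) (triangle u j (suc k))) ⟩
    j * M + (triangle u j (suc k) + triangle u (suc j) (suc k))
      ≤⟨ +-monoʳ-≤ (j * M) (+-monoˡ-≤ _ (triangle-upper j (suc k))) ⟩
    j * M + (M + triangle u (suc j) (suc k))
      ≡⟨ regroup (j * M) M _ ⟩
    suc j * M + triangle u (suc j) (suc k)
      ≡⟨ cong (λ i → suc j * u i + triangle u (suc j) (suc k)) (+-suc j k) ⟩
    suc j * u (suc j + k) + triangle u (suc j) (suc k)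
      ∎
    where
    open ≤-Reasoning
    M : ℕ
    M = u (j + suc k)
    regroup : ∀ a b c → a + (b + c) ≡ b + a + c
    regroup = solve-∀

-- Both inner differences are `y` minus something, so `y` cancels. This computes two rows of the
-- triangle at once below neighbours `d`, `y`, `2 * d`.
∣∣2d-y∣-∣y-d∣∣≡d : ∀ {d y} → 2 * d ≤ y → ∣ ∣ 2 * d - y ∣ - ∣ y - d ∣ ∣ ≡ d
∣∣2d-y∣-∣y-d∣∣≡d {d} {y} 2d≤y = begin
  ∣ ∣ 2 * d - y ∣ - ∣ y - d ∣ ∣
    ≡⟨ cong₂ ∣_-_∣ (m≤n⇒∣m-n∣≡n∸m 2d≤y) (m≤n⇒∣n-m∣≡n∸m (≤-trans (m≤n*m d 2) 2d≤y)) ⟩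
  ∣ y ∸ 2 * d - (y ∸ d) ∣
    ≡⟨ cong (λ z → ∣ z - (y ∸ d) ∣) (trans (cong (λ z → y ∸ (d + z)) (+-identityʳ d)) (sym (∸-+-assoc y d d))) ⟩
  ∣ (y ∸ d) ∸ d - (y ∸ d) ∣
    ≡⟨ m≤n⇒∣m-n∣≡n∸m (m∸n≤m (y ∸ d) d) ⟩
  (y ∸ d) ∸ ((y ∸ d) ∸ d)
    ≡⟨ m∸[m∸n]≡n (m+n≤o⇒m≤o∸n d (subst (λ z → d + z ≤ y) (+-identityʳ d) 2d≤y)) ⟩
  d ∎
  where open ≡-Reasoning

-- The odd rows.

module _ {u : ℕ → ℕ} (u-mono : ∀ n → u n ≤ u (suc n))
  (gap : ∀ m → u (suc (m * 2)) ≡ u (m * 2) + 2 ^ m)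
  (growth : ∀ m → suc m * 2 * u (suc (m * 2)) + 2 ^ suc m ≤ u (suc m * 2)) where

  -- The entry lies on the antidiagonal of `u (suc (i + l) * 2)`, so `growth` at `i + l` outweighs
  -- everything that `triangle-lower` can subtract.
  triangle-odd-odd : ∀ i l → 2 ^ suc l ≤ triangle u (suc (i * 2)) (suc (l * 2))
  triangle-odd-odd i l = +-cancelˡ-≤ (suc (i * 2) * M) _ _ (begin
    suc (i * 2) * M + 2 ^ suc l
      ≤⟨ +-mono-≤ (*-monoˡ-≤ M (≤-trans (n≤1+n _) (*-monoˡ-≤ 2 (s≤s (m≤m+n i l)))))
                  (^-monoʳ-≤ 2 (s≤s (m≤n+m l i))) ⟩
    suc (i + l) * 2 * M + 2 ^ suc (i + l)
      ≤⟨ growth (i + l) ⟩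
    u (suc (i + l) * 2)
      ≡⟨ cong u (trans (cong (2 +_) (*-distribʳ-+ 2 i l)) (sym (+-suc (suc (i * 2)) (l * 2)))) ⟩
    u (suc (i * 2) + suc (l * 2))
      ≤⟨ triangle-lower u-mono (suc (i * 2)) (l * 2) ⟩
    suc (i * 2) * u (suc (i * 2) + l * 2) + triangle u (suc (i * 2)) (suc (l * 2))
      ≡⟨ cong (λ n → suc (i * 2) * u (suc n) + triangle u (suc (i * 2)) (suc (l * 2)))
              (*-distribʳ-+ 2 i l) ⟨
    suc (i * 2) * M + triangle u (suc (i * 2)) (suc (l * 2))
      ∎)
    where
    open ≤-Reasoning
    M : ℕ
    M = u (suc ((i + l) * 2))

  triangle-odd-even : ∀ i l → triangle u (suc (i * 2)) (l * 2) ≡ 2 ^ l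
  triangle-odd-even zero    l =
    trans (cong (λ n → ∣ n - u (l * 2) ∣) (gap l))
      (trans (∣-∣-comm (u (l * 2) + 2 ^ l) (u (l * 2))) (∣m-m+n∣≡n (u (l * 2)) (2 ^ l)))
  triangle-odd-even (suc i) l =
    -- In row `2i + 1` the neighbours of `y` are `2 ^ l` and `2 ^ suc l`, by induction at `l` and
    -- `suc l`.
    trans (cong₂ (λ s t → ∣ ∣ s - y ∣ - ∣ y - t ∣ ∣) (triangle-odd-even i (suc l)) (triangle-odd-even i l))
          (∣∣2d-y∣-∣y-d∣∣≡d (triangle-odd-odd i l))
    where
    y : ℕ
    y = triangle u (suc (i * 2)) (suc (l * 2))

  leftEdge-odd : ∀ j → j % 2 ≡ 1 → leftEdge u j ≡ 1
  leftEdge-odd j j-odd =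
    subst (λ n → leftEdge u n ≡ 1)
      (sym (trans (m≡m%n+[m/n]*n j 2) (cong (_+ j / 2 * 2) j-odd)))
      (triangle-odd-even (j / 2) 0)

-- Interleaving two sequences.

interleave : ∀ {a} {A : Set a} → (ℕ → A) → (ℕ → A) → ℕ → A
interleave f g zero    = f zero
-- The sequences swap roles after each term, so statements about odd positions become statements
-- about even ones.
interleave f g (suc n) = interleave g (f ∘ suc) n

module _ {a} {A : Set a} where

  interleave-even : ∀ (f g : ℕ → A) m → interleave f g (m * 2) ≡ f m
  interleave-even f g zero    = refl
  interleave-even f g (suc m) = interleave-even (f ∘ suc) (g ∘ suc) m

  interleave-odd : ∀ (f g : ℕ → A) m → interleave f g (suc (m * 2)) ≡ g m
  interleave-odd f g = interleave-even g (f ∘ suc)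

  interleave-all : ∀ {p} (P : A → Set p) {f g} → (∀ m → P (f m)) → (∀ m → P (g m)) →
                   ∀ n → P (interleave f g n)
  interleave-all P pf pg zero    = pf zero
  interleave-all P pf pg (suc n) = interleave-all P pg (pf ∘ suc) n

  interleave-steps : ∀ {r} (R : Rel A r) {f g} →
                     (∀ m → R (f m) (g m)) → (∀ m → R (g m) (f (suc m))) →
                     ∀ n → R (interleave f g n) (interleave f g (suc n))
  interleave-steps R fg gf zero    = fg zero
  interleave-steps R fg gf (suc n) = interleave-steps R gf (fg ∘ suc) n

<-steps⇒strictly-increasing : ∀ {u : ℕ → ℕ} → (∀ n → u n < u (suc n)) → u Preserves _<_ ⟶ _<_
<-steps⇒strictly-increasing {u} step {m} m<n = go (≤⇒≤′ m<n)
  where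
  go : ∀ {n} → suc m ≤′ n → u m < u n
  go ≤′-refl       = step m
  go (≤′-step m<n) = <-trans (go m<n) (step _)

-- The sequence.

evens : ℕ → ℕ
evens zero    = proj₁ (cofinal-pairs-2^ 0 0)
-- The requested lower bound is exactly the left side of `growth`; `evens m + 2 ^ m` is the
-- odd-indexed term just before.
evens (suc m) = proj₁ (cofinal-pairs-2^ (suc m) (suc m * 2 * (evens m + 2 ^ m) + 2 ^ suc m))

odds : ℕ → ℕ
odds m = evens m + 2 ^ m

evens-square-prime : ∀ m → SquarePrime (evens m)
evens-square-prime zero    = proj₁ (proj₂ (proj₂ (cofinal-pairs-2^ 0 0)))
evens-square-prime (suc m) = proj₁ (proj₂ (proj₂ (cofinal-pairs-2^ (suc m) _)))

odds-square-prime : ∀ m → SquarePrime (odds m)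
odds-square-prime zero    = proj₂ (proj₂ (proj₂ (cofinal-pairs-2^ 0 0)))
odds-square-prime (suc m) = proj₂ (proj₂ (proj₂ (cofinal-pairs-2^ (suc m) _)))

evens-growth : ∀ m → suc m * 2 * odds m + 2 ^ suc m ≤ evens (suc m)
evens-growth m = proj₁ (proj₂ (cofinal-pairs-2^ (suc m) _))

evens<odds : ∀ m → evens m < odds m
evens<odds m = m<m+n (evens m) (m^n>0 2 m)

odds<evens : ∀ m → odds m < evens (suc m)
odds<evens m = <-≤-trans
  -- The summand `2 ^ suc m` in the bound makes the inequality strict.
  (≤-<-trans (m≤n*m (odds m) (suc m * 2)) (m<m+n (suc m * 2 * odds m) (m^n>0 2 (suc m))))
  (evens-growth m)

theorem2p1 : ∃ λ (A : ℕ → ℕ) →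
    (∀ n → SquarePrime (A n))
    × A Preserves _<_ ⟶ _<_
    × (∀ j → j % 2 ≡ 1 → leftEdge A j ≡ 1)
theorem2p1 =
  A , interleave-all SquarePrime evens-square-prime odds-square-prime ,
  <-steps⇒strictly-increasing steps , leftEdge-odd (<⇒≤ ∘ steps) gap growth
  where
  A : ℕ → ℕ
  A = interleave evens odds

  steps : ∀ n → A n < A (suc n)
  steps = interleave-steps _<_ evens<odds odds<evens

  gap : ∀ m → A (suc (m * 2)) ≡ A (m * 2) + 2 ^ m
  gap m = trans (interleave-odd evens odds m) (cong (_+ 2 ^ m) (sym (interleave-even evens odds m)))

  growth : ∀ m → suc m * 2 * A (suc (m * 2)) + 2 ^ suc m ≤ A (suc m * 2)
  growth m = subst₂ (λ s t → suc m * 2 * s + 2 ^ suc m ≤ t)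
    (sym (interleave-odd evens odds m)) (sym (interleave-even evens odds (suc m))) (evens-growth m)
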